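{- Let $q$ be a prime power and let $n\le m$ be positive integers. An $[n,k,d]_{q^m/q}$ MRD code is rank-metric intersecting if and only if $2d>n$.
   Context: Support and rank: fix an $\mathbb{F}_q$-basis $\Gamma$ of $\mathbb{F}_{q^m}$. For $x=(x_1,\dots,x_n)\in\mathbb{F}_{q^m}^n$ let $\mathrm{Mat}_\Gamma(x)\in\mathbb{F}_q^{m\times n}$ be the matrix whose $j$-th column is the coordinate vector of $x_j$ in the basis $\Gamma$. The support $\sigma(x)\subseteq\mathbb{F}_q^n$ is the $\mathbb{F}_q$-row space of $\mathrm{Mat}_\Gamma(x)$, and $\mathrm{rk}(x)=\dim_{\mathbb{F}_q}\sigma(x)$; both are independent of $\Gamma$. An $[n,k,d]_{q^m/q}$ code is an $\mathbb{F}_{q^m}$-linear subspace $\mathcal{C}$ of $\mathbb{F}_{q^m}^n$ with $k=\dim_{\mathbb{F}_{q^m}}\mathcal{C}\ge 1$ and minimum distance $d=\min_{c\in\mathcal{C}\setminus\{0\}}\mathrm{rk}(c)$. It is an MRD code if it attains equality in the Singleton bound $km\le\max(m,n)(\min(m,n)-d+1)$; for $n\le m$ this means $d=n-k+1$. The code is rank-metric intersecting if $\sigma(c)\cap\sigma(c')\ne\{0\}$ for all $c,c'\in\mathcal{C}\setminus\{0\}$. -}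

module Defs where

open import Algebra.Apartness.Bundles using (HeytingField; HeytingCommutativeRing)
open import Algebra.Bundles using (Ring; CommutativeRing)
open import Algebra.Module.Bundles using (LeftModule)
open import Algebra.Morphism.Bundles using (RingHomomorphism)
import Algebra.Module.Construct.TensorUnit as TensorUnit
import Algebra.Properties.Monoid.Sum as Sum
open import Data.Fin.Base using (Fin)
open import Data.Nat.Base using (ℕ; _+_; _*_; _∸_; _^_; _≤_; _⊔_; _⊓_)
open import Data.Nat.Primality using (Prime)
open import Data.Product.Base using (_×_; _,_; proj₁; proj₂; ∃; ∃-syntax; ∃₂)
open import Data.Unit.Base using (tt)
open import Data.Vec.Functional using (Vector)
open import Function.Bundles using (Inverse)
open import Level using (Level)
open import Relation.Binary.Bundles using (Setoid)
open import Relation.Binary.PropositionalEquality as ≡ using (_≡_)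
open import Relation.Nullary.Negation using (¬_)
open import Relation.Unary using (Pred; U; _∈_; _⊆_; _∩_; _≐_)

PrimePower : ℕ → Set
PrimePower q = ∃₂ λ p e → Prime p × 1 ≤ e × q ≡ p ^ e

HasSize : ∀ {c ℓ : Level} → Setoid c ℓ → ℕ → Set (c Level.⊔ ℓ)
HasSize S n = Inverse S (≡.setoid (Fin n))

-- In a field with finitely many elements equality is decidable, so the
-- apartness of a Heyting field coincides with inequality.
record FiniteField (c ℓ₁ ℓ₂ : Level) (q : ℕ) : Set (Level.suc (c Level.⊔ ℓ₁ Level.⊔ ℓ₂)) where
  field
    heytingField : HeytingField c ℓ₁ ℓ₂

  open HeytingField heytingField using (heytingCommutativeRing)
  open HeytingCommutativeRing heytingCommutativeRing using (commutativeRing)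
  open CommutativeRing commutativeRing public

  field
    size : HasSize setoid q

infix 8 _^ᴹ_

_^ᴹ_ : ∀ {r ℓr m ℓm : Level} {R : Ring r ℓr} → LeftModule R m ℓm → ℕ → LeftModule R m ℓm
M ^ᴹ n = record
  { Carrierᴹ = Vector M.Carrierᴹ n
  ; _≈ᴹ_ = λ u v → ∀ i → u i M.≈ᴹ v i
  ; _+ᴹ_ = λ u v i → u i M.+ᴹ v i
  ; _*ₗ_ = λ a v i → a M.*ₗ v i
  ; 0ᴹ = λ i → M.0ᴹ
  ; -ᴹ_ = λ v i → M.-ᴹ v i
  ; isLeftModule = record
    { isLeftSemimodule = record
      { +ᴹ-isCommutativeMonoid = record
        { isMonoid = record
          { isSemigroup = record
            { isMagma = record
              { isEquivalence = record
                { refl = λ i → M.≈ᴹ-refl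
                ; sym = λ p i → M.≈ᴹ-sym (p i)
                ; trans = λ p q i → M.≈ᴹ-trans (p i) (q i)
                }
              ; ∙-cong = λ p q i → M.+ᴹ-cong (p i) (q i)
              }
            ; assoc = λ u v w i → M.+ᴹ-assoc (u i) (v i) (w i)
            }
          ; identity = (λ v i → M.+ᴹ-identityˡ (v i)) , (λ v i → M.+ᴹ-identityʳ (v i))
          }
        ; comm = λ u v i → M.+ᴹ-comm (u i) (v i)
        }
      ; isPreleftSemimodule = record
        { *ₗ-cong = λ p q i → M.*ₗ-cong p (q i)
        ; *ₗ-zeroˡ = λ v i → M.*ₗ-zeroˡ (v i)
        ; *ₗ-distribʳ = λ v a b i → M.*ₗ-distribʳ (v i) a b
        ; *ₗ-identityˡ = λ v i → M.*ₗ-identityˡ (v i)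
        ; *ₗ-assoc = λ a b v i → M.*ₗ-assoc a b (v i)
        ; *ₗ-zeroʳ = λ a i → M.*ₗ-zeroʳ a
        ; *ₗ-distribˡ = λ a u v i → M.*ₗ-distribˡ a (u i) (v i)
        }
      }
    ; -ᴹ‿cong = λ p i → M.-ᴹ‿cong (p i)
    ; -ᴹ‿inverse = (λ v i → M.-ᴹ‿inverseˡ (v i)) , (λ v i → M.-ᴹ‿inverseʳ (v i))
    }
  }
  where module M = LeftModule M

coordinateSpace : ∀ {r ℓr : Level} (R : Ring r ℓr) → ℕ → LeftModule R r ℓr
coordinateSpace R n = TensorUnit.leftModule {R = R} ^ᴹ n

restrictScalars : ∀ {r ℓr s ℓs m ℓm : Level} {R : Ring r ℓr} {S : Ring s ℓs} →
                  RingHomomorphism (Ring.rawRing R) (Ring.rawRing S) →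
                  LeftModule S m ℓm → LeftModule R m ℓm
restrictScalars φ M = record
  { Carrierᴹ = M.Carrierᴹ
  ; _≈ᴹ_ = M._≈ᴹ_
  ; _+ᴹ_ = M._+ᴹ_
  ; _*ₗ_ = λ a v → φ.⟦ a ⟧ M.*ₗ v
  ; 0ᴹ = M.0ᴹ
  ; -ᴹ_ = M.-ᴹ_
  ; isLeftModule = record
    { isLeftSemimodule = record
      { +ᴹ-isCommutativeMonoid = M.+ᴹ-isCommutativeMonoid
      ; isPreleftSemimodule = record
        { *ₗ-cong = λ p q → M.*ₗ-cong (φ.⟦⟧-cong p) q
        ; *ₗ-zeroˡ = λ v → M.≈ᴹ-trans (M.*ₗ-congʳ φ.0#-homo) (M.*ₗ-zeroˡ v)
        ; *ₗ-distribʳ = λ v a b → M.≈ᴹ-trans (M.*ₗ-congʳ (φ.+-homo a b)) (M.*ₗ-distribʳ v _ _)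
        ; *ₗ-identityˡ = λ v → M.≈ᴹ-trans (M.*ₗ-congʳ φ.1#-homo) (M.*ₗ-identityˡ v)
        ; *ₗ-assoc = λ a b v → M.≈ᴹ-trans (M.*ₗ-congʳ (φ.*-homo a b)) (M.*ₗ-assoc _ _ v)
        ; *ₗ-zeroʳ = λ a → M.*ₗ-zeroʳ _
        ; *ₗ-distribˡ = λ a → M.*ₗ-distribˡ _
        }
      }
    ; -ᴹ‿cong = M.-ᴹ‿cong
    ; -ᴹ‿inverse = M.-ᴹ‿inverse
    }
  }
  where
  module M = LeftModule M
  module φ = RingHomomorphism φ

module LinearAlgebra {r ℓr m ℓm : Level} {R : Ring r ℓr} (M : LeftModule R m ℓm) where
  open Ring R using (Carrier; _≈_; 0#)
  open LeftModule M using (Carrierᴹ; _≈ᴹ_; _+ᴹ_; _*ₗ_; 0ᴹ; +ᴹ-monoid)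

  linearCombination : ∀ {k} → Vector Carrier k → Vector Carrierᴹ k → Carrierᴹ
  linearCombination a v = Sum.sum +ᴹ-monoid (λ i → a i *ₗ v i)

  Span : ∀ {k} → Vector Carrierᴹ k → Pred Carrierᴹ (r Level.⊔ ℓm)
  Span v u = ∃[ a ] u ≈ᴹ linearCombination a v

  LinearlyIndependent : ∀ {k} → Vector Carrierᴹ k → Set (r Level.⊔ ℓr Level.⊔ ℓm)
  LinearlyIndependent v = ∀ a → linearCombination a v ≈ᴹ 0ᴹ → ∀ i → a i ≈ 0#

  ZeroSubspace : Pred Carrierᴹ ℓm
  ZeroSubspace v = v ≈ᴹ 0ᴹ

  record IsSubspace {ℓ : Level} (S : Pred Carrierᴹ ℓ) : Set (r Level.⊔ m Level.⊔ ℓm Level.⊔ ℓ) where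
    field
      resp-≈ : ∀ {u v} → u ≈ᴹ v → u ∈ S → v ∈ S
      0∈ : 0ᴹ ∈ S
      +-closed : ∀ {u v} → u ∈ S → v ∈ S → u +ᴹ v ∈ S
      *-closed : ∀ a {v} → v ∈ S → a *ₗ v ∈ S

  record IsBasis {ℓ : Level} (S : Pred Carrierᴹ ℓ) {k : ℕ} (v : Vector Carrierᴹ k)
                 : Set (r Level.⊔ ℓr Level.⊔ m Level.⊔ ℓm Level.⊔ ℓ) where
    field
      members : ∀ i → v i ∈ S
      independent : LinearlyIndependent v
      spanning : S ⊆ Span v

  HasDimension : ∀ {ℓ : Level} → Pred Carrierᴹ ℓ → ℕ → Set (r Level.⊔ ℓr Level.⊔ m Level.⊔ ℓm Level.⊔ ℓ)
  HasDimension S k = ∃ λ (v : Vector Carrierᴹ k) → IsBasis S v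

module RankMetric
  {c ℓ₁ ℓ₂ c′ ℓ₁′ ℓ₂′ : Level} (q m : ℕ)
  (F : FiniteField c ℓ₁ ℓ₂ q) (K : FiniteField c′ ℓ₁′ ℓ₂′ (q ^ m))
  (ι : RingHomomorphism (FiniteField.rawRing F) (FiniteField.rawRing K))
  where

  private
    module F = FiniteField F
    module K = FiniteField K

  -- K as a vector space over F.
  K/F : LeftModule F.ring c′ ℓ₁′
  K/F = restrictScalars {R = F.ring} {S = K.ring} ι TensorUnit.leftModule

  module Support (Γ : Vector K.Carrier m) (Γ-basis : LinearAlgebra.IsBasis K/F U Γ) (n : ℕ) where

    module F^n = LinearAlgebra (coordinateSpace F.ring n)
    module K^n = LinearAlgebra (coordinateSpace K.ring n)
    open LeftModule (coordinateSpace K.ring n) using (0ᴹ; _≉ᴹ_)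

    -- The witness of spanning is unique up to equality in F, as Γ is independent.
    coordinates : K.Carrier → Vector F.Carrier m
    coordinates x = proj₁ (LinearAlgebra.IsBasis.spanning Γ-basis {x} tt)

    Mat : Vector K.Carrier n → Fin m → Fin n → F.Carrier
    Mat x i j = coordinates (x j) i

    σ : Vector K.Carrier n → Pred (Vector F.Carrier n) (c Level.⊔ ℓ₁)
    σ x = F^n.Span (Mat x)

    HasRank : Vector K.Carrier n → ℕ → Set (c Level.⊔ ℓ₁)
    HasRank x r = F^n.HasDimension (σ x) r

    module _ {ℓ : Level} (C : Pred (Vector K.Carrier n) ℓ) where

      HasMinimumDistance : ℕ → Set (c Level.⊔ ℓ₁ Level.⊔ c′ Level.⊔ ℓ₁′ Level.⊔ ℓ)
      HasMinimumDistance d =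
        (∃[ x ] x ∈ C × x ≉ᴹ 0ᴹ × HasRank x d) ×
        (∀ x → x ∈ C → x ≉ᴹ 0ᴹ → ∀ r → HasRank x r → d ≤ r)

      record IsCode (k d : ℕ) : Set (c Level.⊔ ℓ₁ Level.⊔ c′ Level.⊔ ℓ₁′ Level.⊔ ℓ) where
        field
          isSubspace : K^n.IsSubspace C
          dimension : K^n.HasDimension C k
          1≤k : 1 ≤ k
          minimumDistance : HasMinimumDistance d

      -- Truncated subtraction is harmless: d is a rank, so d ≤ m ⊓ n.
      record IsMRD (k d : ℕ) : Set (c Level.⊔ ℓ₁ Level.⊔ c′ Level.⊔ ℓ₁′ Level.⊔ ℓ) where
        field
          isCode : IsCode k d
          singleton-equality : k * m ≡ (m ⊔ n) * ((m ⊓ n) ∸ d + 1)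

      -- Over finite fields the negation below amounts to the existence of a
      -- nonzero common vector.
      RankMetricIntersecting : Set (c Level.⊔ ℓ₁ Level.⊔ c′ Level.⊔ ℓ₁′ Level.⊔ ℓ)
      RankMetricIntersecting =
        ∀ x y → x ∈ C → y ∈ C → x ≉ᴹ 0ᴹ → y ≉ᴹ 0ᴹ →
        ¬ ((σ x ∩ σ y) ≐ F^n.ZeroSubspace)

-- A family of more than n vectors in an n-dimensional coordinate space is
-- dependent.  If n < 2d, two supports have dimensions at least d, so bases of
-- them with trivial intersection would give an independent family of more than
-- n vectors.  If 2d ≤ n, the Singleton equality gives k = n − d + 1, so C has a
-- nonzero word vanishing on the last n − d coordinates and, as d < k, another
-- one vanishing on the first d; their supports meet trivially.
--
-- Both directions reduce to deriving a contradiction, so bases of spans and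
-- nonzero pivots are only needed up to double negation, which tightness of the
-- apartness provides.

{-# OPTIONS --safe #-}
module Submission where

open import Defs
open import Algebra.Apartness.Bundles using (HeytingField; HeytingCommutativeRing)
import Algebra.Apartness.Properties.HeytingCommutativeRing as HeytingProperties
open import Algebra.Bundles using (Ring; CommutativeRing; Monoid)
open import Algebra.Module.Bundles using (LeftModule)
import Algebra.Module.Properties.LeftModule as LeftModuleProperties
open import Algebra.Morphism.Bundles using (RingHomomorphism)
import Algebra.Properties.CommutativeMonoid.Sum as CommutativeSum
import Algebra.Properties.Monoid.Sum as MonoidSum
import Algebra.Properties.Ring as RingProperties
import Algebra.Properties.Semiring.Sum as SemiringSum
open import Data.Fin.Base using (Fin; zero; suc; splitAt; _↑ˡ_; _↑ʳ_; punchIn)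
open import Data.Fin.Properties using (splitAt-↑ˡ; splitAt-↑ʳ; splitAt⁻¹-↑ˡ; splitAt⁻¹-↑ʳ)
open import Data.Nat.Base using (ℕ; zero; suc; _+_; _*_; _∸_; _⊔_; _⊓_; _^_; _≤_; _<_; z≤n; s≤s; >-nonZero)
open import Data.Nat.Properties as ℕ using (_<?_)
open import Data.Product.Base using (_×_; _,_; proj₁; proj₂; ∃-syntax)
open import Data.Sum.Base using (inj₁; inj₂; [_,_])
open import Data.Unit.Base using (tt)
open import Data.Vec.Functional using (Vector; _∷_; _++_; head; tail; insertAt; removeAt)
open import Data.Vec.Functional.Properties using (insertAt-lookup; insertAt-punchIn)
open import Function.Base using (_∘_; _$_)
open import Function.Bundles using (_⇔_; mk⇔)
open import Level using (Level)
import Relation.Binary.Reasoning.Setoid as ≈-Reasoning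
open import Relation.Binary.PropositionalEquality as ≡ using (_≡_)
open import Relation.Nullary.Decidable using (yes; no; ¬¬-excluded-middle; decidable-stable)
open import Relation.Nullary.Negation using (¬_)
open import Relation.Unary using (Pred; U; _∈_; _⊆_)

-- Sums and linear combinations in a module over a ring.

module _ {a ℓ : Level} (M : Monoid a ℓ) where
  open Monoid M
  open MonoidSum M using (sum)

  sum-++ : ∀ r {s} (t : Vector Carrier (r + s)) →
           sum t ≈ sum (t ∘ (_↑ˡ s)) ∙ sum (t ∘ (r ↑ʳ_))
  sum-++ zero    t = sym (identityˡ _)
  sum-++ (suc r) t = trans (∙-congˡ (sum-++ r (tail t))) (sym (assoc _ _ _))

module LinearCombinations {r ℓr m ℓm : Level} {R : Ring r ℓr} (M : LeftModule R m ℓm) where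
  open Ring R using (Carrier; _≈_; 0#; 1#) renaming (_+_ to _+ᴿ_; _*_ to _*ᴿ_; -_ to -ᴿ_; -‿inverseˡ to -ᴿ-inverseˡ)
  open LeftModule M
  open LeftModuleProperties M using (inverseˡ-uniqueᴹ)
  open LinearAlgebra M
  open CommutativeSum +ᴹ-commutativeMonoid using (sum; sum-cong-≋; ∑-distrib-+; sum-replicate-zero)

  linearCombination-zero : ∀ {k} {a : Vector Carrier k} (v : Vector Carrierᴹ k) →
                           (∀ i → a i ≈ 0#) → linearCombination a v ≈ᴹ 0ᴹ
  linearCombination-zero {k} v a≈0 =
    ≈ᴹ-trans (sum-cong-≋ (λ i → ≈ᴹ-trans (*ₗ-congʳ (a≈0 i)) (*ₗ-zeroˡ (v i)))) (sum-replicate-zero k)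

  linearCombination-+ : ∀ {k} (a b : Vector Carrier k) (v : Vector Carrierᴹ k) →
                        linearCombination (λ i → a i +ᴿ b i) v ≈ᴹ linearCombination a v +ᴹ linearCombination b v
  linearCombination-+ {k} a b v =
    ≈ᴹ-trans (sum-cong-≋ (λ i → *ₗ-distribʳ (v i) (a i) (b i))) (∑-distrib-+ {k} _ _)

  linearCombination-* : ∀ {k} c (a : Vector Carrier k) (v : Vector Carrierᴹ k) →
                        linearCombination (λ i → c *ᴿ a i) v ≈ᴹ c *ₗ linearCombination a v
  linearCombination-* {zero}  c a v = ≈ᴹ-sym (*ₗ-zeroʳ c)
  linearCombination-* {suc k} c a v =
    ≈ᴹ-trans (+ᴹ-cong (*ₗ-assoc c _ _) (linearCombination-* c (tail a) (tail v)))
             (≈ᴹ-sym (*ₗ-distribˡ c _ _))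

  linearCombination-- : ∀ {k} (a : Vector Carrier k) (v : Vector Carrierᴹ k) →
                        linearCombination (λ i → -ᴿ a i) v ≈ᴹ -ᴹ linearCombination a v
  linearCombination-- a v = inverseˡ-uniqueᴹ _ _ $
    ≈ᴹ-trans (≈ᴹ-sym (linearCombination-+ _ a v))
             (linearCombination-zero v (λ i → -ᴿ-inverseˡ (a i)))

  linearCombination-++ : ∀ {r s} (a : Vector Carrier (r + s)) (u : Vector Carrierᴹ r) (w : Vector Carrierᴹ s) →
                         linearCombination a (u ++ w) ≈ᴹ
                         linearCombination (a ∘ (_↑ˡ s)) u +ᴹ linearCombination (a ∘ (r ↑ʳ_)) w
  linearCombination-++ {r} {s} a u w = ≈ᴹ-trans (sum-++ +ᴹ-monoid r _) $ +ᴹ-cong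
    (sum-cong-≋ (λ i → *ₗ-congˡ (≈ᴹ-reflexive (≡.cong [ u , w ] (splitAt-↑ˡ r i s)))))
    (sum-cong-≋ (λ i → *ₗ-congˡ (≈ᴹ-reflexive (≡.cong [ u , w ] (splitAt-↑ʳ r s i)))))

  linearCombination-∈ : ∀ {ℓ} {S : Pred Carrierᴹ ℓ} → IsSubspace S →
                        ∀ {k} (a : Vector Carrier k) {v : Vector Carrierᴹ k} →
                        (∀ i → v i ∈ S) → linearCombination a v ∈ S
  linearCombination-∈ isS {zero}  a v∈S = IsSubspace.0∈ isS
  linearCombination-∈ isS {suc k} a v∈S =
    IsSubspace.+-closed isS (IsSubspace.*-closed isS _ (v∈S zero))
                            (linearCombination-∈ isS (tail a) (v∈S ∘ suc))

  span-⊆ : ∀ {ℓ} {S : Pred Carrierᴹ ℓ} → IsSubspace S →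
           ∀ {k} {v : Vector Carrierᴹ k} → (∀ i → v i ∈ S) → Span v ⊆ S
  span-⊆ isS v∈S (a , x≈) = IsSubspace.resp-≈ isS (≈ᴹ-sym x≈) (linearCombination-∈ isS a v∈S)

  span-isSubspace : ∀ {k} (v : Vector Carrierᴹ k) → IsSubspace (Span v)
  span-isSubspace v = record
    { resp-≈ = λ x≈y (a , x≈) → a , ≈ᴹ-trans (≈ᴹ-sym x≈y) x≈
    ; 0∈ = (λ _ → 0#) , ≈ᴹ-sym (linearCombination-zero v (λ _ → Ring.refl R))
    ; +-closed = λ (a , x≈) (b , y≈) → _ , ≈ᴹ-trans (+ᴹ-cong x≈ y≈) (≈ᴹ-sym (linearCombination-+ a b v))
    ; *-closed = λ c (a , x≈) → _ , ≈ᴹ-trans (*ₗ-congˡ x≈) (≈ᴹ-sym (linearCombination-* c a v))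
    }

  span-tail : ∀ {k} (v : Vector Carrierᴹ (suc k)) → Span (tail v) ⊆ Span v
  span-tail v (a , x≈) = (0# ∷ a) ,
    ≈ᴹ-trans x≈ (≈ᴹ-sym (≈ᴹ-trans (+ᴹ-congʳ (*ₗ-zeroˡ (head v))) (+ᴹ-identityˡ _)))

  head∈span : ∀ {k} (v : Vector Carrierᴹ (suc k)) → head v ∈ Span v
  head∈span v = (1# ∷ λ _ → 0#) , ≈ᴹ-sym (≈ᴹ-trans
    (+ᴹ-cong (*ₗ-identityˡ (head v)) (linearCombination-zero (tail v) (λ _ → Ring.refl R))) (+ᴹ-identityʳ _))

  member∈span : ∀ {k} (v : Vector Carrierᴹ k) i → v i ∈ Span v
  member∈span v zero    = head∈span v
  member∈span v (suc i) = span-tail v (member∈span (tail v) i)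

  -- In a relation among the joined family, the `u`-part `z` is the negative of the `w`-part, so `z`
  -- lies in both spans and is zero. The `w`-part is then zero as well, and the independence of each
  -- family kills its own coefficients.
  independent-++ : ∀ {r s} {u : Vector Carrierᴹ r} {w : Vector Carrierᴹ s} →
                   LinearlyIndependent u → LinearlyIndependent w →
                   (∀ {z} → z ∈ Span u → z ∈ Span w → z ≈ᴹ 0ᴹ) →
                   LinearlyIndependent (u ++ w)
  independent-++ {r} {s} {u} {w} u-ind w-ind disjoint a au+aw≈0 i = helper (splitAt r i) ≡.refl
    where
    a₁ = a ∘ (_↑ˡ s)
    a₂ = a ∘ (r ↑ʳ_)
    z = linearCombination a₁ u
    z+aw≈0 : z +ᴹ linearCombination a₂ w ≈ᴹ 0ᴹ
    z+aw≈0 = ≈ᴹ-trans (≈ᴹ-sym (linearCombination-++ a u w)) au+aw≈0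
    z≈0 : z ≈ᴹ 0ᴹ
    z≈0 = disjoint (a₁ , ≈ᴹ-refl)
      (_ , ≈ᴹ-trans (inverseˡ-uniqueᴹ _ _ z+aw≈0) (≈ᴹ-sym (linearCombination-- a₂ w)))
    aw≈0 : linearCombination a₂ w ≈ᴹ 0ᴹ
    aw≈0 = ≈ᴹ-trans (≈ᴹ-sym (≈ᴹ-trans (+ᴹ-congʳ z≈0) (+ᴹ-identityˡ _))) z+aw≈0
    helper : ∀ j → splitAt r i ≡ j → a i ≈ 0#
    helper (inj₁ j) eq = ≡.subst (λ i → a i ≈ 0#) (splitAt⁻¹-↑ˡ eq) (u-ind a₁ z≈0 j)
    helper (inj₂ j) eq = ≡.subst (λ i → a i ≈ 0#) (splitAt⁻¹-↑ʳ eq) (w-ind a₂ aw≈0 j)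

-- Addition in the coordinate space is pointwise by definition, so the equality is propositional;
-- induction on `k` only serves to unfold the two sums.
linearCombination-coordinate : ∀ {r ℓr} (R : Ring r ℓr) {n k} (a : Vector (Ring.Carrier R) k)
                               (v : Vector (Vector (Ring.Carrier R) n) k) t →
                               LinearAlgebra.linearCombination (coordinateSpace R n) a v t ≡
                               MonoidSum.sum (Ring.+-monoid R) (λ j → Ring._*_ R (a j) (v j t))
linearCombination-coordinate R {k = zero}  a v t = ≡.refl
linearCombination-coordinate R {k = suc k} a v t =
  ≡.cong (Ring._+_ R _) (linearCombination-coordinate R (tail a) (tail v) t)

-- Linear algebra over a Heyting field.

module HeytingLinearAlgebra {c ℓ₁ ℓ₂ : Level} (H : HeytingField c ℓ₁ ℓ₂) where
  open HeytingField H using (heytingCommutativeRing; _#_; tight; #⇒invertible)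
  open HeytingCommutativeRing heytingCommutativeRing using (commutativeRing)
  open CommutativeRing commutativeRing hiding (zero) renaming (_+_ to _+ᴷ_; _*_ to _*ᴷ_)
  open HeytingProperties heytingCommutativeRing using (1#0; x-0≈x)
  open RingProperties ring using (-‿distribˡ-*; -‿distribʳ-*)
  open SemiringSum semiring using (sum; sum-cong-≋; ∑-distrib-+; sum-remove; *-distribʳ-sum; sum-replicate-zero)

  -- By tightness an equation with zero may be proved by refuting apartness, which replaces case
  -- splits on whether an element is zero.
  ¬#0⇒≈0 : ∀ {x} → ¬ x # 0# → x ≈ 0#
  ¬#0⇒≈0 = proj₁ (tight _ _)

  #0⇒≉0 : ∀ {x} → x # 0# → ¬ x ≈ 0#
  #0⇒≉0 x#0 x≈0 = proj₂ (tight _ _) x≈0 x#0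

  #0⇒inverse : ∀ {x} → x # 0# → ∃[ y ] y *ᴷ x ≈ 1#
  #0⇒inverse x#0 with #⇒invertible x#0
  -- `#⇒invertible` inverts the difference with `0#`, hence the rewriting by `x-0≈x`.
  ... | y , yx≈1 , _ = y , trans (*-congˡ (sym (x-0≈x _))) yx≈1

  module _ {m ℓm : Level} (M : LeftModule ring m ℓm) where
    open LeftModule M
    open LeftModuleProperties M using (inverseˡ-uniqueᴹ)
    open LinearAlgebra M
    open LinearCombinations M

    -- A coefficient of `u` apart from zero could be inverted, which would put `u` in the span of
    -- `b`. So that coefficient is zero by tightness, and what remains is a relation among `b`.
    independent-∷ : ∀ {k u} {b : Vector Carrierᴹ k} → ¬ u ∈ Span b → LinearlyIndependent b →
                    LinearlyIndependent (u ∷ b)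
    independent-∷ {u = u} {b} u∉b b-ind a au+ab≈0 = λ { zero → a₀≈0 ; (suc i) → b-ind (tail a) ab≈0 i }
      where
      a₀u∈b : a zero *ₗ u ∈ Span b
      a₀u∈b = _ , ≈ᴹ-trans (inverseˡ-uniqueᴹ _ _ au+ab≈0) (≈ᴹ-sym (linearCombination-- (tail a) b))
      a₀≈0 : a zero ≈ 0#
      a₀≈0 = ¬#0⇒≈0 λ a₀#0 → let (y , ya₀≈1) = #0⇒inverse a₀#0 in
        u∉b (IsSubspace.resp-≈ (span-isSubspace b)
          (≈ᴹ-trans (≈ᴹ-sym (*ₗ-assoc y _ u)) (≈ᴹ-trans (*ₗ-congʳ ya₀≈1) (*ₗ-identityˡ u)))
          (IsSubspace.*-closed (span-isSubspace b) y a₀u∈b))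
      ab≈0 : linearCombination (tail a) b ≈ᴹ 0ᴹ
      ab≈0 = ≈ᴹ-trans (≈ᴹ-sym (≈ᴹ-trans (+ᴹ-congʳ (≈ᴹ-trans (*ₗ-congʳ a₀≈0) (*ₗ-zeroˡ u))) (+ᴹ-identityˡ _))) au+ab≈0

    -- Only ¬¬ of existence: extending a basis requires deciding membership in a span.
    span-hasDimension : ∀ {k} (v : Vector Carrierᴹ k) → ¬ ¬ (∃[ r ] HasDimension (Span v) r)
    span-hasDimension {zero} v ¬dim = ¬dim
      (0 , v , record { members = λ () ; independent = λ _ _ () ; spanning = λ x∈ → x∈ })
    span-hasDimension {suc k} v ¬dim = span-hasDimension (tail v) λ (r , b , isBasis) →
      ¬¬-excluded-middle λ
        { (yes v₀∈b) → ¬dim (r , b , record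
            { members = span-tail v ∘ IsBasis.members isBasis
            ; independent = IsBasis.independent isBasis
            ; spanning = span-⊆ (span-isSubspace b) {v = v}
                λ { zero → v₀∈b ; (suc i) → IsBasis.spanning isBasis (member∈span (tail v) i) }
            })
        ; (no v₀∉b) → ¬dim (suc r , v zero ∷ b , record
            { members = λ { zero → head∈span v ; (suc i) → span-tail v (IsBasis.members isBasis i) }
            ; independent = independent-∷ v₀∉b (IsBasis.independent isBasis)
            ; spanning = span-⊆ (span-isSubspace (v zero ∷ b)) {v = v}
                λ { zero → head∈span (v zero ∷ b)
                  ; (suc i) → span-tail (v zero ∷ b) (IsBasis.spanning isBasis (member∈span (tail v) i)) }
            })
        }

  -- Coordinate vectors: elimination and dependence.

  Independent : ∀ {k n} → Vector (Vector Carrier n) k → Set _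
  Independent {n = n} = LinearAlgebra.LinearlyIndependent (coordinateSpace ring n)

  -- Row vector times matrix, with `v` as the rows. Working with this scalar sum instead of
  -- `linearCombination` makes the sum laws of the semiring applicable.
  coordinate : ∀ {k n} → Vector Carrier k → Vector (Vector Carrier n) k → Fin n → Carrier
  coordinate a v t = sum (λ j → a j *ᴷ v j t)

  independent⇒trivial : ∀ {k n} (v : Vector (Vector Carrier n) k) → Independent v →
                        ∀ a → (∀ t → coordinate a v t ≈ 0#) → ∀ i → a i ≈ 0#
  independent⇒trivial v v-ind a av≈0 =
    v-ind a (λ t → trans (reflexive (linearCombination-coordinate ring a v t)) (av≈0 t))

  trivial⇒independent : ∀ {k n} (v : Vector (Vector Carrier n) k) →
                        (∀ a → (∀ t → coordinate a v t ≈ 0#) → ∀ i → a i ≈ 0#) →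
                        Independent v
  trivial⇒independent v ind a av≈0 =
    ind a (λ t → trans (sym (reflexive (linearCombination-coordinate ring a v t))) (av≈0 t))

  -- One step of Gaussian elimination: row `i` is the pivot row and `y` the inverse of its entry in
  -- column zero. Multiples of the pivot row clear column zero in the other rows; then that row and
  -- that column are dropped.
  module Elimination {k n} (v : Vector (Vector Carrier (suc n)) (suc k)) (i : Fin (suc k))
                     (y : Carrier) (yp≈1 : y *ᴷ v i zero ≈ 1#) where

    eliminated : Vector (Vector Carrier n) k
    eliminated j t = v (punchIn i j) (suc t) +ᴷ v (punchIn i j) zero *ᴷ - (y *ᴷ v i (suc t))

    -- A relation `b` among the eliminated rows lifts to a relation `a` among the rows of `v` once
    -- the pivot row gets a suitable coefficient. Independence of `v` forces `a`, and with it `b`,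
    -- to vanish.
    eliminated-independent : Independent v → Independent eliminated
    eliminated-independent v-ind = trivial⇒independent eliminated λ b be≈0 j →
      trans (sym (reflexive (insertAt-punchIn b i _ j)))
            (independent⇒trivial v v-ind (a b) (av≈0 b be≈0) (punchIn i j))
      where
      open ≈-Reasoning setoid
      module _ (b : Vector Carrier k) where
        S : Fin (suc n) → Carrier
        S = coordinate b (removeAt v i)
        a : Vector Carrier (suc k)
        -- Chosen to cancel `S zero`, the contribution of the other rows in column zero, because
        -- `y *ᴷ v i zero ≈ 1#`.
        a = insertAt b i (- (S zero *ᴷ y))

        av-expand : ∀ t → coordinate a v t ≈ S t +ᴷ S zero *ᴷ - (y *ᴷ v i t)
        av-expand t = begin
          coordinate a v t
            ≈⟨ sum-remove {k} {i} (λ j → a j *ᴷ v j t) ⟩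
          a i *ᴷ v i t +ᴷ sum (λ j → a (punchIn i j) *ᴷ v (punchIn i j) t)
            ≈⟨ +-cong (*-congʳ (reflexive (insertAt-lookup b i _)))
                      (sum-cong-≋ {k} (λ j → *-congʳ (reflexive (insertAt-punchIn b i _ j)))) ⟩
          - (S zero *ᴷ y) *ᴷ v i t +ᴷ S t
            ≈⟨ +-comm _ _ ⟩
          S t +ᴷ - (S zero *ᴷ y) *ᴷ v i t
            ≈⟨ +-congˡ (sym (-‿distribˡ-* _ _)) ⟩
          S t +ᴷ - (S zero *ᴷ y *ᴷ v i t)
            ≈⟨ +-congˡ (-‿cong (*-assoc _ _ _)) ⟩
          S t +ᴷ - (S zero *ᴷ (y *ᴷ v i t))
            ≈⟨ +-congˡ (-‿distribʳ-* _ _) ⟩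
          S t +ᴷ S zero *ᴷ - (y *ᴷ v i t) ∎

        be-expand : ∀ t → coordinate b eliminated t ≈ S (suc t) +ᴷ S zero *ᴷ - (y *ᴷ v i (suc t))
        be-expand t = begin
          coordinate b eliminated t
            ≈⟨ sum-cong-≋ {k} (λ j → trans (distribˡ _ _ _) (+-congˡ (sym (*-assoc _ _ _)))) ⟩
          sum (λ j → b j *ᴷ v (punchIn i j) (suc t) +ᴷ b j *ᴷ v (punchIn i j) zero *ᴷ - (y *ᴷ v i (suc t)))
            ≈⟨ ∑-distrib-+ {k} _ _ ⟩
          S (suc t) +ᴷ sum (λ j → b j *ᴷ v (punchIn i j) zero *ᴷ - (y *ᴷ v i (suc t)))
            ≈⟨ +-congˡ (sym (*-distribʳ-sum {k} _ _)) ⟩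
          S (suc t) +ᴷ S zero *ᴷ - (y *ᴷ v i (suc t)) ∎

        av≈0 : (∀ t → coordinate b eliminated t ≈ 0#) → ∀ t → coordinate a v t ≈ 0#
        av≈0 be≈0 (suc t) = trans (av-expand (suc t)) (trans (sym (be-expand t)) (be≈0 t))
        -- Column zero is absent from `eliminated`; here the choice of the pivot coefficient gives
        -- the cancellation.
        av≈0 be≈0 zero    = trans (av-expand zero) $ begin
          S zero +ᴷ S zero *ᴷ - (y *ᴷ v i zero) ≈⟨ +-congˡ (*-congˡ (-‿cong yp≈1)) ⟩
          S zero +ᴷ S zero *ᴷ - 1#              ≈⟨ +-congʳ (sym (*-identityʳ _)) ⟩
          S zero *ᴷ 1# +ᴷ S zero *ᴷ - 1#        ≈⟨ sym (distribˡ _ _ _) ⟩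
          S zero *ᴷ (1# +ᴷ - 1#)                ≈⟨ *-congˡ (-‿inverseʳ 1#) ⟩
          S zero *ᴷ 0#                          ≈⟨ zeroʳ _ ⟩
          0#                                    ∎

  -- Induction on `n`. With no columns every coefficient vector is a relation, and `1#` is not zero.
  -- Otherwise an entry of column zero apart from zero would serve as a pivot, and elimination would
  -- leave an independent family excluded by induction; so column zero vanishes and is dropped while
  -- all rows stay.
  dependent : ∀ {k n} → n < k → (v : Vector (Vector Carrier n) k) → ¬ Independent v
  dependent {suc k} {zero}  _         v v-ind = #0⇒≉0 1#0 (v-ind (λ _ → 1#) (λ ()) zero)
  dependent {suc k} {suc n} (s≤s n<k) v v-ind = dependent (ℕ.m<n⇒m<1+n n<k) (tail ∘ v) $
    trivial⇒independent (tail ∘ v) λ a atv≈0 → independent⇒trivial v v-ind a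
      λ { zero    → trans (sum-cong-≋ {suc k} (λ j → trans (*-congˡ (v₀≈0 j)) (zeroʳ (a j)))) (sum-replicate-zero (suc k))
        ; (suc t) → atv≈0 t }
    where
    v₀≈0 : ∀ i → v i zero ≈ 0#
    v₀≈0 i = ¬#0⇒≈0 λ p#0 → let (y , yp≈1) = #0⇒inverse p#0 in
      dependent n<k (Elimination.eliminated v i y yp≈1) (Elimination.eliminated-independent v i y yp≈1 v-ind)

  -- Restricting to the coordinates p gives too many vectors in a smaller space.
  ¬¬∃-vanishing : ∀ {n k e ℓ} {C : Pred (Vector Carrier n) ℓ} →
                  LinearAlgebra.IsSubspace (coordinateSpace ring n) C →
                  LinearAlgebra.HasDimension (coordinateSpace ring n) C k →
                  e < k → (p : Fin e → Fin n) →
                  ¬ ¬ (∃[ x ] x ∈ C × ¬ (∀ j → x j ≈ 0#) × (∀ t → x (p t) ≈ 0#))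
  ¬¬∃-vanishing {n} isC (v , isBasis) e<k p ¬∃ = dependent e<k (λ i → v i ∘ p) $
    -- A relation `a` among the restricted basis vectors yields a member of `C` vanishing along `p`.
    -- Were some coefficient apart from zero, independence of `v` would make this member nonzero,
    -- against `¬∃`.
    trivial⇒independent (λ i → v i ∘ p) λ a avp≈0 i → ¬#0⇒≈0 λ aᵢ#0 → ¬∃
      ( linearCombination a v
      , LinearCombinations.linearCombination-∈ (coordinateSpace ring n) isC a (IsBasis.members isBasis)
      , (λ x≈0 → #0⇒≉0 aᵢ#0 (IsBasis.independent isBasis a x≈0 i))
      , (λ t → trans (reflexive (linearCombination-coordinate ring a v (p t))) (avp≈0 t)) )
    where open LinearAlgebra (coordinateSpace ring n)

-- MRD codes: dimension, supports and the two implications.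

MRD-dimension : ∀ {n m k} d → 1 ≤ m → n ≤ m → k * m ≡ (m ⊔ n) * ((m ⊓ n) ∸ d + 1) → k ≡ n ∸ d + 1
-- As `n ≤ m`, the maximum is `m` and the minimum is `n`; the positive factor `m` then cancels.
MRD-dimension {n} {m} {k} d 1≤m n≤m eq = ℕ.*-cancelʳ-≡ k (n ∸ d + 1) m {{>-nonZero 1≤m}} $ begin
  k * m                         ≡⟨ eq ⟩
  (m ⊔ n) * ((m ⊓ n) ∸ d + 1)   ≡⟨ ≡.cong₂ (λ x y → x * (y ∸ d + 1)) (ℕ.m≥n⇒m⊔n≡m n≤m) (ℕ.m≥n⇒m⊓n≡n n≤m) ⟩
  m * (n ∸ d + 1)               ≡⟨ ℕ.*-comm m _ ⟩
  (n ∸ d + 1) * m               ∎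
  where open ≡.≡-Reasoning

module _ {c ℓ₁ ℓ₂ c′ ℓ₁′ ℓ₂′ : Level} (q m n : ℕ)
         (F : FiniteField c ℓ₁ ℓ₂ q) (K : FiniteField c′ ℓ₁′ ℓ₂′ (q ^ m))
         (ι : RingHomomorphism (FiniteField.rawRing F) (FiniteField.rawRing K))
         (Γ : Vector (FiniteField.Carrier K) m)
         (Γ-basis : LinearAlgebra.IsBasis (RankMetric.K/F q m F K ι) U Γ) where
  open RankMetric.Support q m F K ι Γ Γ-basis n
  private
    module F = FiniteField F
    module K = FiniteField K
    module HF = HeytingLinearAlgebra F.heytingField
    module HK = HeytingLinearAlgebra K.heytingField
    Fⁿ = coordinateSpace F.ring n

  -- The coordinates of `x` are a spanning witness, so for vanishing `x` they form a relation among
  -- the independent family `Γ`.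
  coordinates-zero : ∀ {x} → x K.≈ K.0# → ∀ i → coordinates x i F.≈ F.0#
  coordinates-zero {x} x≈0 = LinearAlgebra.IsBasis.independent Γ-basis (coordinates x)
    (K.trans (K.sym (proj₂ (LinearAlgebra.IsBasis.spanning Γ-basis {x} tt))) x≈0)

  -- A zero entry of `x` gives a zero column of `Mat x`, and every combination of the rows vanishes
  -- in that column.
  σ-zero : ∀ {x z j} → x j K.≈ K.0# → z ∈ σ x → z j F.≈ F.0#
  σ-zero {x} {z} {j} xj≈0 (a , z≈) =
    F.trans (z≈ j) $ F.trans (F.reflexive (linearCombination-coordinate F.ring a (Mat x) j)) $
    F.trans (sum-cong-≋ {m} (λ i → F.trans (F.*-congˡ (coordinates-zero xj≈0 i)) (F.zeroʳ _))) (sum-replicate-zero m)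
    where open SemiringSum F.semiring using (sum-cong-≋; sum-replicate-zero)

  module _ {ℓ : Level} (C : Pred (Vector K.Carrier n) ℓ) where
    large-distance⇒intersecting : ∀ {k d} → IsCode C k d → n < 2 * d → RankMetricIntersecting C
    large-distance⇒intersecting {k} {d} isCode n<2d x y x∈C y∈C x≉0 y≉0 (disjoint , _) =
      HF.span-hasDimension Fⁿ (Mat x) λ (r , u , u-basis) →
      HF.span-hasDimension Fⁿ (Mat y) λ (s , w , w-basis) →
      HF.dependent
        (ℕ.<-≤-trans n<2d (ℕ.+-mono-≤ (d≤ x x∈C x≉0 r (u , u-basis))
          -- `2 * d` unfolds to `d + (d + 0)`, so the second summand to be bounded is `d + 0`.
          (≡.subst (_≤ s) (≡.sym (ℕ.+-identityʳ d)) (d≤ y y∈C y≉0 s (w , w-basis)))))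
        (u ++ w)
        (independent-++ (F^n.IsBasis.independent u-basis) (F^n.IsBasis.independent w-basis)
          -- Trivial intersection is assumed for the supports, while `independent-++` asks for it on
          -- the spans of the two bases.
          λ z∈u z∈w → disjoint (basis⊆ u-basis z∈u , basis⊆ w-basis z∈w))
      where
      open LinearCombinations Fⁿ
      d≤ = proj₂ (IsCode.minimumDistance isCode)
      basis⊆ : ∀ {x r} {u : Vector _ r} → F^n.IsBasis (σ x) u → F^n.Span u ⊆ σ x
      basis⊆ {x} u-basis = span-⊆ (span-isSubspace (Mat x)) (F^n.IsBasis.members u-basis)

    -- Here `e` stands for `n − d`. Replacing `n` by `d + e` lets `splitAt` and the two injections
    -- address the first `d` and the last `e` coordinates.
    small-distance⇒¬intersecting : ∀ {k d e} → d + e ≡ n → d ≤ e → k ≡ e + 1 → IsCode C k d →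
                                   ¬ RankMetricIntersecting C
    small-distance⇒¬intersecting {d = d} {e} ≡.refl d≤e ≡.refl isCode intersecting =
      -- The dimension `e + 1` exceeds by one the number of last coordinates on which `x` has to
      -- vanish.
      HK.¬¬∃-vanishing isSubspace dimension (ℕ.m<m+n e (s≤s z≤n)) (d ↑ʳ_) λ (x , x∈C , x≉0 , x≈0) →
      -- For `y` the first `d` coordinates are prescribed, and `d ≤ e < e + 1`.
      HK.¬¬∃-vanishing isSubspace dimension (ℕ.≤-<-trans d≤e (ℕ.m<m+n e (s≤s z≤n))) (_↑ˡ e) λ (y , y∈C , y≉0 , y≈0) →
      intersecting x y x∈C y∈C x≉0 y≉0
        ( (λ {z} (z∈x , z∈y) j → zero-everywhere x≈0 y≈0 z∈x z∈y j (splitAt d j) ≡.refl)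
        , λ z≈0 → 0∈σ x z≈0 , 0∈σ y z≈0 )
      where
      open IsCode isCode
      -- Each coordinate lies in the first block, where `y` vanishes, or in the last, where `x`
      -- vanishes; `σ-zero` settles both cases.
      zero-everywhere : ∀ {x y z} → (∀ t → x (d ↑ʳ t) K.≈ K.0#) → (∀ t → y (t ↑ˡ e) K.≈ K.0#) →
                        z ∈ σ x → z ∈ σ y → ∀ j s → splitAt d j ≡ s → z j F.≈ F.0#
      zero-everywhere {x} {y} {z} x≈0 y≈0 z∈x z∈y j (inj₁ t) eq =
        ≡.subst (λ j → z j F.≈ F.0#) (splitAt⁻¹-↑ˡ eq) (σ-zero {y} (y≈0 t) z∈y)
      zero-everywhere {x} {y} {z} x≈0 y≈0 z∈x z∈y j (inj₂ t) eq =
        ≡.subst (λ j → z j F.≈ F.0#) (splitAt⁻¹-↑ʳ eq) (σ-zero {x} (x≈0 t) z∈x)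
      0∈σ : ∀ x {z} → z ∈ F^n.ZeroSubspace → z ∈ σ x
      0∈σ x z≈0 = F^n.IsSubspace.resp-≈ isS (λ i → F.sym (z≈0 i)) (F^n.IsSubspace.0∈ isS)
        where isS = LinearCombinations.span-isSubspace Fⁿ (Mat x)

proposition2p8 : ∀ {c ℓ₁ ℓ₂ c′ ℓ₁′ ℓ₂′ ℓ : Level} (q m n : ℕ) →
    PrimePower q → 1 ≤ n → 1 ≤ m → n ≤ m →
    (F : FiniteField c ℓ₁ ℓ₂ q) (K : FiniteField c′ ℓ₁′ ℓ₂′ (q ^ m))
    (ι : RingHomomorphism (FiniteField.rawRing F) (FiniteField.rawRing K))
    (Γ : Vector (FiniteField.Carrier K) m)
    (Γ-basis : LinearAlgebra.IsBasis (RankMetric.K/F q m F K ι) U Γ) →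
    let open RankMetric.Support q m F K ι Γ Γ-basis n in
    (C : Pred (Vector (FiniteField.Carrier K) n) ℓ) (k d : ℕ) →
    IsMRD C k d →
    RankMetricIntersecting C ⇔ n < 2 * d
proposition2p8 q m n _ _ 1≤m n≤m F K ι Γ Γ-basis C k d isMRD = mk⇔
  -- Decidability of `n < 2 * d` allows a proof by contradiction, so words known to exist only up to
  -- double negation suffice.
  (λ intersecting → decidable-stable (n <? 2 * d) λ n≮2d →
    let 2d≤n = ℕ.≮⇒≥ n≮2d
        d≤n = ℕ.≤-trans (ℕ.m≤m+n d _) 2d≤n
        -- Subtract `d` from both sides of `d + (d + 0) ≤ n`.
        d≤n∸d = ≡.subst (_≤ n ∸ d) (≡.trans (ℕ.m+n∸m≡n d (d + 0)) (ℕ.+-identityʳ d)) (ℕ.∸-monoˡ-≤ d 2d≤n)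
    -- The parameter `e` becomes `n ∸ d`, so the Singleton equality supplies `k ≡ e + 1`.
    in small-distance⇒¬intersecting q m n F K ι Γ Γ-basis C
         (ℕ.m+[n∸m]≡n d≤n) d≤n∸d (MRD-dimension d 1≤m n≤m singleton-equality) isCode intersecting)
  (large-distance⇒intersecting q m n F K ι Γ Γ-basis C isCode)
  where open RankMetric.Support.IsMRD isMRD
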